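{- (Contraction isomorphism) For every coherence space $A$ there is a canonical linear isomorphism between $\mathrm{flag}\,A$ and $(\mathrm{flag}\,A)\triangleleft(\mathrm{flag}\,A)$.
   Context: A coherence space $A$ is a set $|A|$ (its web, possibly infinite, whose elements are called tokens) endowed with a reflexive and symmetric binary relation on $|A|$, called coherence and written $\alpha\sim\alpha'\,[A]$. Strict coherence $\alpha\frown\alpha'\,[A]$ means $\alpha\sim\alpha'\,[A]$ and $\alpha\neq\alpha'$. A clique of $A$ is a set of pairwise coherent tokens. Linear morphisms from $A$ to $B$ are maps $F$ from cliques of $A$ to cliques of $B$ that are monotone for inclusion, commute with unions of families of pairwise compatible cliques (two cliques being compatible when their union is a clique), and satisfy $F(x\cap x')=F(x)\cap F(x')$ whenever $x\cup x'$ is a clique. They compose as maps. A linear isomorphism is an invertible linear morphism whose inverse is linear. The connective "before": $A\triangleleft B$ is the coherence space with web $|A|\times|B|$, in which $(\alpha,\beta)\sim(\alpha',\beta')\,[A\triangleleft B]$ iff $\alpha\frown\alpha'\,[A]$ or ($\alpha=\alpha'$ and $\beta\sim\beta'\,[B]$). Let $2^{\omega}$ be the set of infinite words on $\{0,1\}$, with the product topology (Cantor space) and the lexicographic total order: $w_1<w_2$ iff there are a finite word $m$ and infinite words $w_1',w_2'$ with $w_1=m0w_1'$ and $w_2=m1w_2'$. For a coherence space $A$, the coherence space $\mathrm{flag}\,A$ is defined as follows. Its web is the set of continuous functions from $2^\omega$ to $|A|$, where $|A|$ has the discrete topology. Two functions $f,g$ in this web are strictly coherent, $f\frown g\,[\mathrm{flag}\,A]$,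 iff there exists $w\in 2^\omega$ such that $f(w)\frown g(w)\,[A]$ and $f(w')=g(w')$ for all $w'<w$. -}

module Defs where

open import Level using (Level; _⊔_; suc; 0ℓ)
open import Data.Bool.Base using (Bool; true; false)
open import Data.List.Base using (List; []; _∷_)
open import Data.Nat.Base as ℕ using (ℕ)
open import Data.Product using (∃-syntax; _×_; _,_; proj₁; proj₂)
open import Data.Product.Relation.Binary.Pointwise.NonDependent using (×-setoid)
open import Data.Sum.Base using (_⊎_; inj₁; inj₂)
open import Function.Base using (_∘_; _on_)
open import Function.Bundles using (Func; _⇔_; mk⇔; _⟨$⟩_)
open import Relation.Binary.Bundles using (Setoid)
open import Relation.Binary.Core using (Rel)
open import Relation.Binary.Definitions using (Reflexive; Symmetric; _Respects_; _Respects₂_; _Respectsʳ_)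
open import Relation.Binary.PropositionalEquality using (_≡_; _≗_; _→-setoid_)
open import Relation.Nullary.Negation using (¬_; contradiction)
open import Relation.Unary using (Pred; _∈_; _⊆_; _≐_; _∪_; _∩_; _⊢_; ⋃)

private
  variable
    c ℓ r c′ ℓ′ r′ p : Level

-- Webs are setoids, since equality of tokens of `flag A` is pointwise
-- equality of functions.
record CoherenceSpace c ℓ r : Set (suc (c ⊔ ℓ ⊔ r)) where
  infix 4 _∼_ _⌢_
  field
    Web     : Setoid c ℓ
  open Setoid Web public
    renaming (Carrier to Token; refl to ≈-refl; sym to ≈-sym; trans to ≈-trans)
    using (_≈_)
  field
    _∼_      : Rel Token r
    ∼-refl   : Reflexive _∼_
    ∼-sym    : Symmetric _∼_
    ∼-resp-≈ : _∼_ Respects₂ _≈_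

  _⌢_ : Rel Token (ℓ ⊔ r)
  α ⌢ α′ = α ∼ α′ × ¬ (α ≈ α′)

  ⌢-sym : Symmetric _⌢_
  ⌢-sym (α∼α′ , α≉α′) = ∼-sym α∼α′ , α≉α′ ∘ ≈-sym

  ⌢-resp-≈ : _⌢_ Respects₂ _≈_
  ⌢-resp-≈ =
      (λ y≈z (x∼y , x≉y) → proj₁ ∼-resp-≈ y≈z x∼y , λ x≈z → x≉y (≈-trans x≈z (≈-sym y≈z)))
    , (λ y≈z (y∼x , y≉x) → proj₂ ∼-resp-≈ y≈z y∼x , λ z≈x → y≉x (≈-trans y≈z z≈x))

private
  sym∧respʳ⇒resp₂ : {X : Set c} {_≈_ : Rel X ℓ} {_∼_ : Rel X r} →
                    Symmetric _∼_ → _∼_ Respectsʳ _≈_ → _∼_ Respects₂ _≈_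
  sym∧respʳ⇒resp₂ sym respʳ = respʳ , λ y≈z y∼x → sym (respʳ y≈z (sym y∼x))

module _ (A : CoherenceSpace c ℓ r) where
  open CoherenceSpace A

  PairwiseCoherent : Pred Token p → Set _
  PairwiseCoherent x = ∀ {α α′} → α ∈ x → α′ ∈ x → α ∼ α′

  record Clique p : Set (c ⊔ ℓ ⊔ r ⊔ suc p) where
    field
      tokens   : Pred Token p
      respects : tokens Respects _≈_
      coherent : PairwiseCoherent tokens

open Clique public using (tokens)

module _ {A : CoherenceSpace c ℓ r} where
  open Clique

  infix 4 _⊆ᶜ_ _≐ᶜ_
  infixr 7 _∩ᶜ_

  _⊆ᶜ_ : Rel (Clique A p) _
  _⊆ᶜ_ = _⊆_ on tokens

  _≐ᶜ_ : Rel (Clique A p) _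
  _≐ᶜ_ = _≐_ on tokens

  Compatible : Rel (Clique A p) _
  Compatible x x′ = PairwiseCoherent A (tokens x ∪ tokens x′)

  _∩ᶜ_ : Clique A p → Clique A p → Clique A p
  x ∩ᶜ x′ = record
    { tokens   = tokens x ∩ tokens x′
    ; respects = λ α≈α′ (α∈x , α∈x′) → respects x α≈α′ α∈x , respects x′ α≈α′ α∈x′
    ; coherent = λ (α∈x , _) (α′∈x , _) → coherent x α∈x α′∈x
    }

  ⋃ᶜ : {I : Set p} (x : I → Clique A p) → (∀ i j → Compatible (x i) (x j)) → Clique A p
  ⋃ᶜ {I = I} x compatible = record
    { tokens   = ⋃ I (tokens ∘ x)
    ; respects = λ α≈α′ (i , α∈xᵢ) → i , respects (x i) α≈α′ α∈xᵢ
    ; coherent = λ (i , α∈xᵢ) (j , α′∈xⱼ) → compatible i j (inj₁ α∈xᵢ) (inj₂ α′∈xⱼ)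
    }

record IsLinear {A : CoherenceSpace c ℓ r} {B : CoherenceSpace c′ ℓ′ r′}
                (F : Clique A p → Clique B p) :
                Set (c ⊔ ℓ ⊔ r ⊔ c′ ⊔ ℓ′ ⊔ r′ ⊔ suc p) where
  field
    monotone : ∀ {x x′} → x ⊆ᶜ x′ → F x ⊆ᶜ F x′
    union    : {I : Set p} (x : I → Clique A p) (compatible : ∀ i j → Compatible (x i) (x j)) →
               tokens (F (⋃ᶜ x compatible)) ≐ ⋃ I (tokens ∘ F ∘ x)
    meet     : ∀ x x′ → Compatible x x′ → F (x ∩ᶜ x′) ≐ᶜ F x ∩ᶜ F x′

record LinearIso (A : CoherenceSpace c ℓ r) (B : CoherenceSpace c′ ℓ′ r′) p :
                 Set (c ⊔ ℓ ⊔ r ⊔ c′ ⊔ ℓ′ ⊔ r′ ⊔ suc p) where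
  field
    to          : Clique A p → Clique B p
    from        : Clique B p → Clique A p
    to-linear   : IsLinear to
    from-linear : IsLinear from
    to∘from     : ∀ y → to (from y) ≐ᶜ y
    from∘to     : ∀ x → from (to x) ≐ᶜ x

infixr 6 _◁_

_◁_ : CoherenceSpace c ℓ r → CoherenceSpace c′ ℓ′ r′ →
      CoherenceSpace (c ⊔ c′) (ℓ ⊔ ℓ′) (ℓ ⊔ r ⊔ r′)
_◁_ {c} {ℓ} {r} {c′} {ℓ′} {r′} A B = record
  { Web      = web
  ; _∼_      = _~_
  ; ∼-refl   = inj₂ (A.≈-refl , B.∼-refl)
  ; ∼-sym    = ~-sym
  ; ∼-resp-≈ = sym∧respʳ⇒resp₂ {_≈_ = Setoid._≈_ web} {_∼_ = _~_} ~-sym ~-respʳ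
  }
  where
  module A = CoherenceSpace A
  module B = CoherenceSpace B

  web : Setoid (c ⊔ c′) (ℓ ⊔ ℓ′)
  web = ×-setoid A.Web B.Web

  _~_ : Rel (A.Token × B.Token) (ℓ ⊔ r ⊔ r′)
  (α , β) ~ (α′ , β′) = (α A.⌢ α′) ⊎ ((α A.≈ α′) × (β B.∼ β′))

  ~-sym : Symmetric _~_
  ~-sym (inj₁ α⌢α′)          = inj₁ (A.⌢-sym α⌢α′)
  ~-sym (inj₂ (α≈α′ , β∼β′)) = inj₂ (A.≈-sym α≈α′ , B.∼-sym β∼β′)

  ~-respʳ : _~_ Respectsʳ Setoid._≈_ web
  ~-respʳ (p , q) (inj₁ α⌢α′)          = inj₁ (proj₁ A.⌢-resp-≈ p α⌢α′)
  ~-respʳ (p , q) (inj₂ (α≈α′ , β∼β′)) = inj₂ (A.≈-trans α≈α′ p , proj₁ B.∼-resp-≈ q β∼β′)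

-- Infinite words, with `false` and `true` for the letters 0 and 1.

2^ω : Setoid 0ℓ 0ℓ
2^ω = ℕ →-setoid Bool

Word : Set
Word = Setoid.Carrier 2^ω

infixr 5 _∷ω_ _++ω_

_∷ω_ : Bool → Word → Word
(b ∷ω w) ℕ.zero    = b
(b ∷ω w) (ℕ.suc n) = w n

_++ω_ : List Bool → Word → Word
[]      ++ω w = w
(b ∷ m) ++ω w = b ∷ω (m ++ω w)

infix 4 _<_

_<_ : Rel Word 0ℓ
w₁ < w₂ = ∃[ m ] ∃[ w₁′ ] ∃[ w₂′ ] (w₁ ≗ m ++ω (false ∷ω w₁′)) × (w₂ ≗ m ++ω (true ∷ω w₂′))

-- The basic open neighbourhood of w in the product topology: the words
-- sharing with w their prefix of length n.
Cylinder : Word → ℕ → Pred Word 0ℓ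
Cylinder w n w′ = ∀ i → i ℕ.< n → w i ≡ w′ i

Open : Pred Word p → Set p
Open U = ∀ {w} → w ∈ U → ∃[ n ] Cylinder w n ⊆ U

-- Continuity into a discrete space: every subset of a discrete space is
-- open, a subset of a setoid being a predicate compatible with equality.
Continuous : (X : Setoid c ℓ) → Func 2^ω X → Set (c ⊔ suc ℓ)
Continuous {ℓ = ℓ} X f =
  ∀ (U : Pred (Setoid.Carrier X) ℓ) → U Respects Setoid._≈_ X → Open ((f ⟨$⟩_) ⊢ U)

record FlagToken (A : CoherenceSpace c ℓ r) : Set (c ⊔ suc ℓ) where
  private module A = CoherenceSpace A
  field
    func       : Func 2^ω A.Web
    continuous : Continuous A.Web func

  infixl 9 _·_

  _·_ : Word → A.Token
  _·_ = func ⟨$⟩_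

open FlagToken public using (_·_)

module _ {A : CoherenceSpace c ℓ r} where
  private module A = CoherenceSpace A

  infix 4 _≈ᶠ_ _⌢ᶠ_

  _≈ᶠ_ : Rel (FlagToken A) ℓ
  f ≈ᶠ g = ∀ w → f · w A.≈ g · w

  _⌢ᶠ_ : Rel (FlagToken A) (ℓ ⊔ r)
  f ⌢ᶠ g = ∃[ w ] (f · w A.⌢ g · w) × (∀ w′ → w′ < w → f · w′ A.≈ g · w′)

flag : CoherenceSpace c ℓ r → CoherenceSpace (c ⊔ suc ℓ) ℓ (ℓ ⊔ r)
flag {c} {ℓ} {r} A = record
  { Web      = web
  ; _∼_      = _~_
  ; ∼-refl   = inj₁ (λ w → A.≈-refl)
  ; ∼-sym    = λ {f} {g} → ~-sym {f} {g}
  ; ∼-resp-≈ = sym∧respʳ⇒resp₂ {_≈_ = _≈ᶠ_} {_∼_ = _~_}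
                 (λ {f} {g} → ~-sym {f} {g}) (λ {f} {g} {h} → ~-respʳ {f} {g} {h})
  }
  where
  module A = CoherenceSpace A

  web : Setoid (c ⊔ suc ℓ) ℓ
  web = record
    { Carrier       = FlagToken A
    ; _≈_           = _≈ᶠ_
    ; isEquivalence = record
      { refl  = λ w → A.≈-refl
      ; sym   = λ f≈g w → A.≈-sym (f≈g w)
      ; trans = λ f≈g g≈h w → A.≈-trans (f≈g w) (g≈h w)
      }
    }

  _~_ : Rel (FlagToken A) (ℓ ⊔ r)
  f ~ g = f ≈ᶠ g ⊎ f ⌢ᶠ g

  ~-sym : Symmetric _~_
  ~-sym (inj₁ f≈g)               = inj₁ (λ w → A.≈-sym (f≈g w))
  ~-sym (inj₂ (w , fw⌢gw , f≈g)) = inj₂ (w , A.⌢-sym fw⌢gw , λ w′ w′<w → A.≈-sym (f≈g w′ w′<w))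

  ~-respʳ : _~_ Respectsʳ _≈ᶠ_
  ~-respʳ g≈h (inj₁ f≈g)               = inj₁ (λ w → A.≈-trans (f≈g w) (g≈h w))
  ~-respʳ g≈h (inj₂ (w , fw⌢gw , f≈g)) =
    inj₂ (w , proj₁ A.⌢-resp-≈ (g≈h w) fw⌢gw , λ w′ w′<w → A.≈-trans (f≈g w′ w′<w) (g≈h w′))

-- Coherence in `flag A` is the reflexive closure of `_⌢ᶠ_`; the strict
-- coherence it induces is `_⌢ᶠ_` again.
flag-⌢ : (A : CoherenceSpace c ℓ r) (f g : FlagToken A) →
         CoherenceSpace._⌢_ (flag A) f g ⇔ f ⌢ᶠ g
flag-⌢ A f g = mk⇔
  (λ { (inj₁ f≈g , f≉g) → contradiction f≈g f≉g
     ; (inj₂ f⌢g , _)   → f⌢g })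
  (λ { (w , fw⌢gw , f≈g) → inj₂ (w , fw⌢gw , f≈g) , λ f≈g → proj₂ fw⌢gw (f≈g w) })

-- The graph of h ↦ (h₀ , h₁), where h₀(w) = h(0w) and h₁(w) = h(1w).
Splits : (A : CoherenceSpace c ℓ r) → FlagToken A → FlagToken A × FlagToken A → Set ℓ
Splits A h (h₀ , h₁) =
  (∀ w → h₀ · w ≈ h · (false ∷ω w)) ×
  (∀ w → h₁ · w ≈ h · (true ∷ω w))
  where open CoherenceSpace A using (_≈_)

-- The trace of the canonical isomorphism is the graph `Splits`; this fixes
-- its value on every clique.
IsCanonical : (A : CoherenceSpace c ℓ r) → LinearIso (flag A) (flag A ◁ flag A) p → Set _
IsCanonical A Φ = ∀ x →
  tokens (LinearIso.to Φ x) ≐ λ h₀₁ → ∃[ h ] h ∈ tokens x × Splits A h h₀₁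

{-# OPTIONS --safe #-}

-- A word is a letter followed by a word, and every word beginning with 0
-- precedes every word beginning with 1.  Hence a continuous function on 2^ω is
-- a pair of continuous functions, on 0·2^ω and on 1·2^ω, and the first point at
-- which two functions disagree lies in the second half only if they agree on
-- the whole first half: this is the coherence of `flag A ◁ flag A`.  Splitting
-- is thus an isomorphism of webs preserving and reflecting coherence, and such
-- an isomorphism acts linearly on cliques.
module Submission where

open import Level using (Level)
open import Data.Bool.Base using (Bool; true; false)
open import Data.List.Base using ([]; _∷_)
open import Data.Nat.Base as ℕ using (z<s; s<s)
open import Data.Nat.Properties using (<⇒≤)
open import Data.Product using (Σ-syntax; _×_; _,_; proj₁; proj₂)
open import Data.Sum.Base using (_⊎_; inj₁; inj₂)
open import Function.Base using (id; _∘_)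
open import Function.Bundles using (Func; Inverse; Equivalence; _⇔_; mk⇔)
open import Relation.Binary.PropositionalEquality using (_≡_; refl; sym; trans; subst; _≗_)
open import Relation.Unary using (_⊢_)
open import Defs

private
  variable
    c ℓ r c′ ℓ′ r′ p : Level

module _ {A : CoherenceSpace c ℓ r} {B : CoherenceSpace c′ ℓ′ r′} where
  private
    module A = CoherenceSpace A
    module B = CoherenceSpace B

  -- Inverse images need no existential: closure under equality follows from congruence of `φ`, and
  -- coherence only asks that `φ` reflect it.
  preimage : (φ : Func B.Web A.Web) →
             (∀ β β′ → Func.to φ β A.∼ Func.to φ β′ → β B.∼ β′) →
             Clique A p → Clique B p
  preimage φ reflects x = record
    { tokens   = Func.to φ ⊢ tokens x
    ; respects = λ β≈β′ → Clique.respects x (Func.cong φ β≈β′)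
    ; coherent = λ β∈ β′∈ → reflects _ _ (Clique.coherent x β∈ β′∈)
    }

  -- Inverse image commutes definitionally with unions and intersections.
  preimage-linear : ∀ φ reflects → IsLinear {p = p} (preimage φ reflects)
  preimage-linear φ reflects = record
    { monotone = λ x⊆x′ → x⊆x′
    ; union    = λ _ _ → id , id
    ; meet     = λ _ _ _ → id , id
    }

module _ {A : CoherenceSpace c ℓ r} {B : CoherenceSpace c′ ℓ′ r′} where
  private
    module A = CoherenceSpace A
    module B = CoherenceSpace B

  webIso⇒linearIso : (I : Inverse A.Web B.Web) →
                     (∀ β β′ → Inverse.from I β A.∼ Inverse.from I β′ ⇔ β B.∼ β′) →
                     LinearIso A B p
  webIso⇒linearIso I from-∼ = record
    { to          = preimage fromFunc from-reflects
    ; from        = preimage toFunc to-reflects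
    ; to-linear   = preimage-linear fromFunc from-reflects
    ; from-linear = preimage-linear toFunc to-reflects
    ; to∘from     = λ y → Clique.respects y (I.strictlyInverseˡ _)
                        , Clique.respects y (B.≈-sym (I.strictlyInverseˡ _))
    ; from∘to     = λ x → Clique.respects x (I.strictlyInverseʳ _)
                        , Clique.respects x (A.≈-sym (I.strictlyInverseʳ _))
    }
    where
    module I = Inverse I

    toFunc : Func A.Web B.Web
    toFunc = record { to = I.to ; cong = I.to-cong }

    fromFunc : Func B.Web A.Web
    fromFunc = record { to = I.from ; cong = I.from-cong }

    from-reflects : ∀ β β′ → I.from β A.∼ I.from β′ → β B.∼ β′
    from-reflects β β′ = Equivalence.to (from-∼ β β′)

    to-reflects : ∀ α α′ → I.to α B.∼ I.to α′ → α A.∼ α′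
    -- Coherence of the images passes through `I.from`; the round trips then return to `α` and `α′`.
    to-reflects α α′ =
      proj₁ A.∼-resp-≈ (I.strictlyInverseʳ α′) ∘
      proj₂ A.∼-resp-≈ (I.strictlyInverseʳ α) ∘
      Equivalence.from (from-∼ (I.to α) (I.to α′))

head : Word → Bool
head w = w 0

tail : Word → Word
tail w n = w (ℕ.suc n)

head∷tail : ∀ {b} w → head w ≡ b → b ∷ω tail w ≗ w
head∷tail w hw ℕ.zero    = sym hw
head∷tail w hw (ℕ.suc n) = refl

∷ω-cong : ∀ b {w w′} → w ≗ w′ → b ∷ω w ≗ b ∷ω w′
∷ω-cong b w≗w′ ℕ.zero    = refl
∷ω-cong b w≗w′ (ℕ.suc n) = w≗w′ n

<-head : ∀ {u w} → head u ≡ false → head w ≡ true → u < w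
<-head {u} {w} hu hw =
  [] , tail u , tail w , sym ∘ head∷tail u hu , sym ∘ head∷tail w hw

<-tail : ∀ {u w} → head u ≡ head w → tail u < tail w → u < w
<-tail {u} {w} hu≡hw (m , u′ , w′ , u≗ , w≗) = head w ∷ m , u′ , w′
  , (λ { ℕ.zero → hu≡hw ; (ℕ.suc n) → u≗ n })
  , (λ { ℕ.zero → refl  ; (ℕ.suc n) → w≗ n })

-- An empty common prefix puts the difference at the first letter; otherwise that letter is shared
-- and can be stripped.
<-cases : ∀ {u w} → u < w →
          (head u ≡ false × head w ≡ true) ⊎ (head u ≡ head w × tail u < tail w)
<-cases ([]    , u′ , w′ , u≗ , w≗) = inj₁ (u≗ 0 , w≗ 0)
<-cases (b ∷ m , u′ , w′ , u≗ , w≗) =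
  inj₂ (trans (u≗ 0) (sym (w≗ 0)) , m , u′ , w′ , u≗ ∘ ℕ.suc , w≗ ∘ ℕ.suc)

module _ (A : CoherenceSpace c ℓ r) where
  private
    module A = CoherenceSpace A
    module F = CoherenceSpace (flag A)
    module F◁F = CoherenceSpace (flag A ◁ flag A)

  half : Bool → FlagToken A → FlagToken A
  half b h = record
    { func       = func
    ; continuous = continuous
    }
    where
    func : Func 2^ω A.Web
    func = record
      { to   = λ w → h · (b ∷ω w)
      ; cong = λ w≗w′ → Func.cong (FlagToken.func h) (∷ω-cong b w≗w′)
      }

    continuous : Continuous A.Web func
    continuous U resp {w} hw∈U with FlagToken.continuous h U resp hw∈U
    -- Prefixing `b` only lengthens the agreement, so the same `n` suffices.
    ... | n , cyl⊆ = n , λ {w′} w′∈cyl → cyl⊆ {b ∷ω w′} λ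
      { ℕ.zero    _    → refl
      ; (ℕ.suc i) si<n → w′∈cyl i (<⇒≤ si<n) }

  split : FlagToken A → FlagToken A × FlagToken A
  split h = half false h , half true h

  part : FlagToken A × FlagToken A → Bool → FlagToken A
  part (f₀ , f₁) false = f₀
  part (f₀ , f₁) true  = f₁

  glue : FlagToken A × FlagToken A → FlagToken A
  glue f = record
    { func       = func
    ; continuous = continuous
    }
    where
    part-cong : ∀ {b b′ w w′} → b ≡ b′ → w ≗ w′ → part f b · w A.≈ part f b′ · w′
    part-cong {b} refl = Func.cong (FlagToken.func (part f b))

    func : Func 2^ω A.Web
    func = record
      { to   = λ w → part f (head w) · tail w
      ; cong = λ w≗w′ → part-cong (w≗w′ 0) (w≗w′ ∘ ℕ.suc)
      }

    continuous : Continuous A.Web func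
    continuous U resp {w} fw∈U with FlagToken.continuous (part f (head w)) U resp fw∈U
    -- One extra letter fixes which half is used; the other `n` control the tail.
    ... | n , cyl⊆ = ℕ.suc n , λ {w′} w′∈cyl →
      subst (λ b → U (part f b · tail w′)) (w′∈cyl 0 z<s)
        (cyl⊆ (λ i i<n → w′∈cyl (ℕ.suc i) (s<s i<n)))

  -- Every word is its first letter followed by its tail, so the halves determine `h`. Since
  -- `Splits A h f` unfolds to equality of `f` with `split h`, this also serves as an inverse law.
  splits⇒≈-glue : ∀ {h f} → Splits A h f → h F.≈ glue f
  splits⇒≈-glue {h} (h₀≈ , h₁≈) w with head w in hw
  ... | false = A.≈-sym (A.≈-trans (h₀≈ (tail w)) (Func.cong (FlagToken.func h) (head∷tail w hw)))
  ... | true  = A.≈-sym (A.≈-trans (h₁≈ (tail w)) (Func.cong (FlagToken.func h) (head∷tail w hw)))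

  glue-splits : ∀ f → Splits A (glue f) f
  glue-splits f = (λ w → A.≈-refl) , (λ w → A.≈-refl)

  splitting : Inverse F.Web F◁F.Web
  splitting = record
    { to        = split
    ; from      = glue
    ; to-cong   = λ f≈g → (λ w → f≈g (false ∷ω w)) , (λ w → f≈g (true ∷ω w))
    ; from-cong = λ {f} {g} f≈g → splits⇒≈-glue {glue f} {g}
        ((λ w → A.≈-sym (proj₁ f≈g w)) , (λ w → A.≈-sym (proj₂ f≈g w)))
    ; inverse   =
        (λ h≈ → (λ w → h≈ (false ∷ω w)) , (λ w → h≈ (true ∷ω w)))
      , (λ {h} {f} f≈ w → A.≈-sym (splits⇒≈-glue {h} {f} f≈ w))
    }

  glue-⌢⇒∼ : ∀ f g → glue f ⌢ᶠ glue g → f F◁F.∼ g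
  glue-⌢⇒∼ f g (w , fw⌢gw , f≈g) with head w in hw
  ... | false = inj₁ (Equivalence.from (flag-⌢ A (proj₁ f) (proj₁ g))
                  (tail w , fw⌢gw , λ v v<w → f≈g (false ∷ω v) (<-tail (sym hw) v<w)))
  -- All of the first half lies below `w`, so the first components agree everywhere.
  ... | true  = inj₂ ( (λ v → f≈g (false ∷ω v) (<-head refl hw))
                     , inj₂ (tail w , fw⌢gw , λ v v<w → f≈g (true ∷ω v) (<-tail (sym hw) v<w)))

  ⌢₀⇒glue-⌢ : ∀ f g → proj₁ f ⌢ᶠ proj₁ g → glue f ⌢ᶠ glue g
  ⌢₀⇒glue-⌢ f g (w , fw⌢gw , f≈g) = false ∷ω w , fw⌢gw , below
    where
    below : ∀ v → v < false ∷ω w → glue f · v A.≈ glue g · v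
    below v v<w with head v | <-cases v<w
    -- The omitted cases would equate distinct letters.
    ... | false | inj₂ (_ , v<w′) = f≈g (tail v) v<w′

  ⌢₁⇒glue-⌢ : ∀ f g → proj₁ f F.≈ proj₁ g → proj₂ f ⌢ᶠ proj₂ g → glue f ⌢ᶠ glue g
  ⌢₁⇒glue-⌢ f g f₀≈g₀ (w , fw⌢gw , f≈g) = true ∷ω w , fw⌢gw , below
    where
    below : ∀ v → v < true ∷ω w → glue f · v A.≈ glue g · v
    below v v<w with head v | <-cases v<w
    ... | false | _               = f₀≈g₀ (tail v)
    ... | true  | inj₂ (_ , v<w′) = f≈g (tail v) v<w′

  glue-∼ : ∀ f g → glue f F.∼ glue g ⇔ f F◁F.∼ g
  glue-∼ f g = mk⇔
    (λ { (inj₁ f≈g) → inj₂ ((λ w → f≈g (false ∷ω w)) , inj₁ (λ w → f≈g (true ∷ω w)))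
       ; (inj₂ f⌢g) → glue-⌢⇒∼ f g f⌢g })
    (λ { (inj₁ f₀⌢g₀) →
           inj₂ (⌢₀⇒glue-⌢ f g (Equivalence.to (flag-⌢ A (proj₁ f) (proj₁ g)) f₀⌢g₀))
       ; (inj₂ (f₀≈g₀ , inj₁ f₁≈g₁)) →
           inj₁ (Inverse.from-cong splitting {f} {g} (f₀≈g₀ , f₁≈g₁))
       ; (inj₂ (f₀≈g₀ , inj₂ f₁⌢g₁)) → inj₂ (⌢₁⇒glue-⌢ f g f₀≈g₀ f₁⌢g₁) })

proposition17 : ∀ {c ℓ r : Level} (p : Level) (A : CoherenceSpace c ℓ r) →
    Σ[ Φ ∈ LinearIso (flag A) (flag A ◁ flag A) p ] IsCanonical A Φ
proposition17 p A = webIso⇒linearIso (splitting A) (glue-∼ A) , λ x →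
    -- Membership of `f` in the image means `glue A f` is in `x`, so `glue A f` is the witness;
    -- conversely any `h` splitting into `f` equals it, and `x` respects equality.
    (λ {f} glue-f∈x → glue A f , glue-f∈x , glue-splits A f)
  , (λ {f} (h , h∈x , h-splits) →
       Clique.respects x (splits⇒≈-glue A {h} {f} h-splits) h∈x)
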